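{- Let $\ell:K(H\times\mathrm{Id})\to HM$ be an abstract GSOS rule with $\ell$-interpretation $b:KC\to C$, and let $k=c^{ -1}\cdot Hb^\sharp:HMC\to C$. Then $(C,k)$ is a completely iterative algebra for the functor $HM$.
   Context: Let $\mathcal A$ be a category with binary products and coproducts, let $H:\mathcal A\to\mathcal A$ be a functor with a terminal coalgebra $c:C\to HC$ (so $c$ is an isomorphism by Lambek's lemma), and let $K:\mathcal A\to\mathcal A$ be a functor such that every object $X$ has a free $K$-algebra $\varphi_X:KMX\to MX$ with universal morphism $\eta_X:X\to MX$. Then $(M,\eta,\mu)$ is the free monad on $K$, and $\kappa=\varphi\cdot K\eta:K\to M$. For a $K$-algebra $a:KA\to A$ let $a^\sharp:MA\to A$ be the unique $K$-algebra homomorphism with $a^\sharp\cdot\eta_A=\mathrm{id}_A$; it is an Eilenberg–Moore algebra for $M$. An abstract GSOS rule is a natural transformation $\ell:K(H\times\mathrm{Id})\to HM$; its $\ell$-interpretation is the unique morphism $b:KC\to C$ with $c\cdot b=Hb^\sharp\cdot\ell_C\cdot K\langle c,\mathrm{id}_C\rangle$. For an endofunctor $G$, a flat equation morphism in an object $A$ is a morphism $e:X\to GX+A$; a $G$-algebra $a:GA\to A$ is a completely iterative algebra (cia) if every flat equation morphism $e:X\to GX+A$ has a unique solution, i.e. a unique $e^\dagger:X\to A$ with $e^\dagger=[a,\mathrm{id}_A]\cdot(Ge^\dagger+\mathrm{id}_A)\cdot e$. -}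

module Defs where

open import Level using (Level; suc; _⊔_)
open import Data.Product using (∃!)
open import Relation.Binary.Bundles using (Setoid)
open import Relation.Binary.Structures using (IsEquivalence)
import Relation.Binary.Reasoning.Setoid as SetoidReasoning

-- Hom-sets are setoids, so equality of morphisms (and every uniqueness clause
-- below) is _≈_.
record Category (o h e : Level) : Set (suc (o ⊔ h ⊔ e)) where
  infix  4 _≈_ _⇒_
  infixr 9 _∘_
  field
    Obj : Set o
    _⇒_ : Obj → Obj → Set h
    _≈_ : ∀ {A B} → A ⇒ B → A ⇒ B → Set e
    id  : ∀ {A} → A ⇒ A
    _∘_ : ∀ {A B C} → B ⇒ C → A ⇒ B → A ⇒ C

    equiv     : ∀ {A B} → IsEquivalence (_≈_ {A} {B})
    ∘-resp-≈  : ∀ {A B C} {f f′ : B ⇒ C} {g g′ : A ⇒ B} → f ≈ f′ → g ≈ g′ → f ∘ g ≈ f′ ∘ g′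
    assoc     : ∀ {A B C D} {f : A ⇒ B} {g : B ⇒ C} {k : C ⇒ D} → (k ∘ g) ∘ f ≈ k ∘ (g ∘ f)
    identityˡ : ∀ {A B} {f : A ⇒ B} → id ∘ f ≈ f
    identityʳ : ∀ {A B} {f : A ⇒ B} → f ∘ id ≈ f

  hom-setoid : ∀ {A B : Obj} → Setoid h e
  hom-setoid {A} {B} = record { Carrier = A ⇒ B ; _≈_ = _≈_ ; isEquivalence = equiv }

  module Equiv {A B : Obj} = IsEquivalence (equiv {A} {B})
  module HomReasoning {A B : Obj} = SetoidReasoning (hom-setoid {A} {B})

  ∘-resp-≈ˡ : ∀ {A B C} {f f′ : B ⇒ C} {g : A ⇒ B} → f ≈ f′ → f ∘ g ≈ f′ ∘ g
  ∘-resp-≈ˡ p = ∘-resp-≈ p Equiv.refl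

  ∘-resp-≈ʳ : ∀ {A B C} {f : B ⇒ C} {g g′ : A ⇒ B} → g ≈ g′ → f ∘ g ≈ f ∘ g′
  ∘-resp-≈ʳ p = ∘-resp-≈ Equiv.refl p

record Functor {o h e o′ h′ e′ : Level} (𝒞 : Category o h e) (𝒟 : Category o′ h′ e′)
    : Set (o ⊔ h ⊔ e ⊔ o′ ⊔ h′ ⊔ e′) where
  private
    module 𝒞 = Category 𝒞
    module 𝒟 = Category 𝒟
  field
    F₀ : 𝒞.Obj → 𝒟.Obj
    F₁ : ∀ {A B} → A 𝒞.⇒ B → F₀ A 𝒟.⇒ F₀ B

    F-resp-≈     : ∀ {A B} {f g : A 𝒞.⇒ B} → f 𝒞.≈ g → F₁ f 𝒟.≈ F₁ g
    identity     : ∀ {A} → F₁ (𝒞.id {A}) 𝒟.≈ 𝒟.id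
    homomorphism : ∀ {A B C} {f : A 𝒞.⇒ B} {g : B 𝒞.⇒ C} → F₁ (g 𝒞.∘ f) 𝒟.≈ F₁ g 𝒟.∘ F₁ f

Endofunctor : {o h e : Level} → Category o h e → Set (o ⊔ h ⊔ e)
Endofunctor 𝒞 = Functor 𝒞 𝒞

module _ {o h e : Level} {𝒞 : Category o h e} where
  open Category 𝒞

  idF : Endofunctor 𝒞
  idF = record
    { F₀           = λ A → A
    ; F₁           = λ f → f
    ; F-resp-≈     = λ p → p
    ; identity     = Equiv.refl
    ; homomorphism = Equiv.refl
    }

  infixr 9 _∘F_

  _∘F_ : Endofunctor 𝒞 → Endofunctor 𝒞 → Endofunctor 𝒞
  G ∘F F = record
    { F₀           = λ A → G.F₀ (F.F₀ A)
    ; F₁           = λ f → G.F₁ (F.F₁ f)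
    ; F-resp-≈     = λ p → G.F-resp-≈ (F.F-resp-≈ p)
    ; identity     = Equiv.trans (G.F-resp-≈ F.identity) G.identity
    ; homomorphism = Equiv.trans (G.F-resp-≈ F.homomorphism) G.homomorphism
    }
    where
      module G = Functor G
      module F = Functor F

record NaturalTransformation {o h e : Level} {𝒞 : Category o h e} (F G : Endofunctor 𝒞)
    : Set (o ⊔ h ⊔ e) where
  open Category 𝒞
  private
    module F = Functor F
    module G = Functor G
  field
    η       : ∀ X → F.F₀ X ⇒ G.F₀ X
    commute : ∀ {X Y} (f : X ⇒ Y) → η Y ∘ F.F₁ f ≈ G.F₁ f ∘ η X

record BinaryProducts {o h e : Level} (𝒞 : Category o h e) : Set (o ⊔ h ⊔ e) where
  open Category 𝒞
  infixr 7 _×_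
  field
    _×_   : Obj → Obj → Obj
    π₁    : ∀ {A B} → A × B ⇒ A
    π₂    : ∀ {A B} → A × B ⇒ B
    ⟨_,_⟩ : ∀ {A B X} → X ⇒ A → X ⇒ B → X ⇒ A × B

    project₁ : ∀ {A B X} {f : X ⇒ A} {g : X ⇒ B} → π₁ ∘ ⟨ f , g ⟩ ≈ f
    project₂ : ∀ {A B X} {f : X ⇒ A} {g : X ⇒ B} → π₂ ∘ ⟨ f , g ⟩ ≈ g
    unique   : ∀ {A B X} {f : X ⇒ A} {g : X ⇒ B} {u : X ⇒ A × B}
             → π₁ ∘ u ≈ f → π₂ ∘ u ≈ g → ⟨ f , g ⟩ ≈ u

  infixr 7 _×₁_

  _×₁_ : ∀ {A B A′ B′} → A ⇒ A′ → B ⇒ B′ → A × B ⇒ A′ × B′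
  f ×₁ g = ⟨ f ∘ π₁ , g ∘ π₂ ⟩

record BinaryCoproducts {o h e : Level} (𝒞 : Category o h e) : Set (o ⊔ h ⊔ e) where
  open Category 𝒞
  infixr 6 _+_
  field
    _+_   : Obj → Obj → Obj
    i₁    : ∀ {A B} → A ⇒ A + B
    i₂    : ∀ {A B} → B ⇒ A + B
    [_,_] : ∀ {A B X} → A ⇒ X → B ⇒ X → A + B ⇒ X

    inject₁ : ∀ {A B X} {f : A ⇒ X} {g : B ⇒ X} → [ f , g ] ∘ i₁ ≈ f
    inject₂ : ∀ {A B X} {f : A ⇒ X} {g : B ⇒ X} → [ f , g ] ∘ i₂ ≈ g
    unique  : ∀ {A B X} {f : A ⇒ X} {g : B ⇒ X} {u : A + B ⇒ X}
            → u ∘ i₁ ≈ f → u ∘ i₂ ≈ g → [ f , g ] ≈ u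

  infixr 6 _+₁_

  _+₁_ : ∀ {A B A′ B′} → A ⇒ A′ → B ⇒ B′ → A + B ⇒ A′ + B′
  f +₁ g = [ i₁ ∘ f , i₂ ∘ g ]

module _ {o h e : Level} {𝒞 : Category o h e} (products : BinaryProducts 𝒞) where
  open Category 𝒞
  open BinaryProducts products

  productFunctor : Endofunctor 𝒞 → Endofunctor 𝒞 → Endofunctor 𝒞
  productFunctor F G = record
    { F₀           = λ X → F.F₀ X × G.F₀ X
    ; F₁           = λ f → F.F₁ f ×₁ G.F₁ f
    ; F-resp-≈     = λ p → unique
        (Equiv.trans project₁ (∘-resp-≈ˡ (Equiv.sym (F.F-resp-≈ p))))
        (Equiv.trans project₂ (∘-resp-≈ˡ (Equiv.sym (G.F-resp-≈ p))))
    ; identity     = unique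
        (Equiv.trans identityʳ (Equiv.sym (Equiv.trans (∘-resp-≈ˡ F.identity) identityˡ)))
        (Equiv.trans identityʳ (Equiv.sym (Equiv.trans (∘-resp-≈ˡ G.identity) identityˡ)))
    ; homomorphism = unique
        (slide project₁ project₁ F.homomorphism)
        (slide project₂ project₂ G.homomorphism)
    }
    where
      module F = Functor F
      module G = Functor G

      slide : ∀ {X Y Z A B D} {p : Y ⇒ Z} {q : X ⇒ Y} {r : A ⇒ B} {s : B ⇒ Z} {t : D ⇒ A}
                {u : X ⇒ B} {v : D ⇒ X} {w : A ⇒ Z}
            → p ∘ q ≈ s ∘ u → u ∘ v ≈ r ∘ t → w ≈ s ∘ r → p ∘ (q ∘ v) ≈ w ∘ t
      slide {p = p} {q} {r} {s} {t} {u} {v} {w} e₁ e₂ e₃ = begin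
        p ∘ (q ∘ v)  ≈⟨ assoc ⟨
        (p ∘ q) ∘ v  ≈⟨ ∘-resp-≈ˡ e₁ ⟩
        (s ∘ u) ∘ v  ≈⟨ assoc ⟩
        s ∘ (u ∘ v)  ≈⟨ ∘-resp-≈ʳ e₂ ⟩
        s ∘ (r ∘ t)  ≈⟨ assoc ⟨
        (s ∘ r) ∘ t  ≈⟨ ∘-resp-≈ˡ e₃ ⟨
        w ∘ t        ∎
        where open HomReasoning

module _ {o h e : Level} {𝒞 : Category o h e} (H : Endofunctor 𝒞) where
  open Category 𝒞
  open Functor H

  IsCoalgebraHom : ∀ {A B} → A ⇒ F₀ A → B ⇒ F₀ B → A ⇒ B → Set e
  IsCoalgebraHom a b f = b ∘ f ≈ F₁ f ∘ a

  record TerminalCoalgebra : Set (o ⊔ h ⊔ e) where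
    field
      C : Obj
      c : C ⇒ F₀ C

      unfold        : ∀ {A} → A ⇒ F₀ A → A ⇒ C
      unfold-hom    : ∀ {A} (a : A ⇒ F₀ A) → IsCoalgebraHom a c (unfold a)
      unfold-unique : ∀ {A} (a : A ⇒ F₀ A) {f : A ⇒ C} → IsCoalgebraHom a c f → f ≈ unfold a

    c⁻¹ : F₀ C ⇒ C
    c⁻¹ = unfold (F₁ c)

    -- Lambek's lemma.
    c⁻¹∘c≈id : c⁻¹ ∘ c ≈ id
    c⁻¹∘c≈id = Equiv.trans
      (unfold-unique c (begin
        c ∘ (c⁻¹ ∘ c)        ≈⟨ assoc ⟨
        (c ∘ c⁻¹) ∘ c        ≈⟨ ∘-resp-≈ˡ (unfold-hom (F₁ c)) ⟩
        (F₁ c⁻¹ ∘ F₁ c) ∘ c  ≈⟨ ∘-resp-≈ˡ homomorphism ⟨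
        F₁ (c⁻¹ ∘ c) ∘ c     ∎))
      (Equiv.sym (unfold-unique c (begin
        c ∘ id       ≈⟨ identityʳ ⟩
        c            ≈⟨ identityˡ ⟨
        id ∘ c       ≈⟨ ∘-resp-≈ˡ identity ⟨
        F₁ id ∘ c    ∎)))
      where open HomReasoning

    c∘c⁻¹≈id : c ∘ c⁻¹ ≈ id
    c∘c⁻¹≈id = begin
      c ∘ c⁻¹         ≈⟨ unfold-hom (F₁ c) ⟩
      F₁ c⁻¹ ∘ F₁ c   ≈⟨ homomorphism ⟨
      F₁ (c⁻¹ ∘ c)    ≈⟨ F-resp-≈ c⁻¹∘c≈id ⟩
      F₁ id           ≈⟨ identity ⟩
      id              ∎
      where open HomReasoning

module _ {o h e : Level} {𝒞 : Category o h e} (K : Endofunctor 𝒞) where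
  open Category 𝒞
  open Functor K

  IsAlgebraHom : ∀ {A B} → F₀ A ⇒ A → F₀ B ⇒ B → A ⇒ B → Set e
  IsAlgebraHom a b f = f ∘ a ≈ b ∘ F₁ f

  record FreeAlgebra (X : Obj) : Set (o ⊔ h ⊔ e) where
    field
      MX : Obj
      φ  : F₀ MX ⇒ MX
      η  : X ⇒ MX

      extend        : ∀ {A} → F₀ A ⇒ A → X ⇒ A → MX ⇒ A
      extend-hom    : ∀ {A} (a : F₀ A ⇒ A) (f : X ⇒ A) → IsAlgebraHom φ a (extend a f)
      extend-η      : ∀ {A} (a : F₀ A ⇒ A) (f : X ⇒ A) → extend a f ∘ η ≈ f
      extend-unique : ∀ {A} (a : F₀ A ⇒ A) (f : X ⇒ A) {g : MX ⇒ A}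
                    → IsAlgebraHom φ a g → g ∘ η ≈ f → g ≈ extend a f

module FreeMonad {o h e : Level} {𝒞 : Category o h e} (K : Endofunctor 𝒞)
                 (free : (X : Category.Obj 𝒞) → FreeAlgebra K X) where
  open Category 𝒞
  private
    module K = Functor K
    module Free (X : Obj) = FreeAlgebra (free X)

  M₀ : Obj → Obj
  M₀ = Free.MX

  φ : ∀ X → K.F₀ (M₀ X) ⇒ M₀ X
  φ = Free.φ

  η : ∀ X → X ⇒ M₀ X
  η = Free.η

  M₁ : ∀ {X Y} → X ⇒ Y → M₀ X ⇒ M₀ Y
  M₁ {X} {Y} f = Free.extend X (φ Y) (η Y ∘ f)

  -- The functor part of the free monad: M f is the K-algebra homomorphism
  -- extending η ∘ f.
  M : Endofunctor 𝒞
  M = record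
    { F₀           = M₀
    ; F₁           = M₁
    ; F-resp-≈     = λ {X} {Y} {f} {g} p → Free.extend-unique X (φ Y) (η Y ∘ g)
        (Free.extend-hom X (φ Y) (η Y ∘ f))
        (Equiv.trans (Free.extend-η X (φ Y) (η Y ∘ f)) (∘-resp-≈ʳ p))
    ; identity     = λ {X} → Equiv.sym (Free.extend-unique X (φ X) (η X ∘ id)
        (Equiv.trans identityˡ
          (Equiv.sym (Equiv.trans (∘-resp-≈ʳ K.identity) identityʳ)))
        (Equiv.trans identityˡ (Equiv.sym identityʳ)))
    ; homomorphism = λ {X} {Y} {Z} {f} {g} →
        Equiv.sym (Free.extend-unique X (φ Z) (η Z ∘ (g ∘ f)) (hom f g) (unit f g))
    }
    where
      open HomReasoning

      hom : ∀ {X Y Z} (f : X ⇒ Y) (g : Y ⇒ Z) → IsAlgebraHom K (φ X) (φ Z) (M₁ g ∘ M₁ f)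
      hom {X} {Y} {Z} f g = begin
        (M₁ g ∘ M₁ f) ∘ φ X              ≈⟨ assoc ⟩
        M₁ g ∘ (M₁ f ∘ φ X)              ≈⟨ ∘-resp-≈ʳ (Free.extend-hom X (φ Y) (η Y ∘ f)) ⟩
        M₁ g ∘ (φ Y ∘ K.F₁ (M₁ f))       ≈⟨ assoc ⟨
        (M₁ g ∘ φ Y) ∘ K.F₁ (M₁ f)       ≈⟨ ∘-resp-≈ˡ (Free.extend-hom Y (φ Z) (η Z ∘ g)) ⟩
        (φ Z ∘ K.F₁ (M₁ g)) ∘ K.F₁ (M₁ f) ≈⟨ assoc ⟩
        φ Z ∘ (K.F₁ (M₁ g) ∘ K.F₁ (M₁ f)) ≈⟨ ∘-resp-≈ʳ K.homomorphism ⟨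
        φ Z ∘ K.F₁ (M₁ g ∘ M₁ f)         ∎

      unit : ∀ {X Y Z} (f : X ⇒ Y) (g : Y ⇒ Z) → (M₁ g ∘ M₁ f) ∘ η X ≈ η Z ∘ (g ∘ f)
      unit {X} {Y} {Z} f g = begin
        (M₁ g ∘ M₁ f) ∘ η X  ≈⟨ assoc ⟩
        M₁ g ∘ (M₁ f ∘ η X)  ≈⟨ ∘-resp-≈ʳ (Free.extend-η X (φ Y) (η Y ∘ f)) ⟩
        M₁ g ∘ (η Y ∘ f)     ≈⟨ assoc ⟨
        (M₁ g ∘ η Y) ∘ f     ≈⟨ ∘-resp-≈ˡ (Free.extend-η Y (φ Z) (η Z ∘ g)) ⟩
        (η Z ∘ g) ∘ f        ≈⟨ assoc ⟩
        η Z ∘ (g ∘ f)        ∎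

  infix 10 _♯

  _♯ : ∀ {A} → K.F₀ A ⇒ A → M₀ A ⇒ A
  _♯ {A} a = Free.extend A a id

module _ {o h e : Level} {𝒞 : Category o h e} (coproducts : BinaryCoproducts 𝒞)
         (G : Endofunctor 𝒞) where
  open Category 𝒞
  open BinaryCoproducts coproducts
  open Functor G

  FlatEquation : Obj → Obj → Set h
  FlatEquation X A = X ⇒ F₀ X + A

  IsSolution : ∀ {X A} → F₀ A ⇒ A → FlatEquation X A → X ⇒ A → Set e
  IsSolution a eq s = s ≈ [ a , id ] ∘ (F₁ s +₁ id) ∘ eq

  IsCIA : ∀ {A} → F₀ A ⇒ A → Set (o ⊔ h ⊔ e)
  IsCIA {A} a = ∀ {X} (eq : FlatEquation X A) → ∃! _≈_ (IsSolution a eq)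

module AbstractGSOS {o h e : Level} {𝒜 : Category o h e} (products : BinaryProducts 𝒜)
                    (H : Endofunctor 𝒜) (terminal : TerminalCoalgebra H)
                    (K : Endofunctor 𝒜) (free : (X : Category.Obj 𝒜) → FreeAlgebra K X) where
  open Category 𝒜
  open BinaryProducts products using (⟨_,_⟩)
  open TerminalCoalgebra terminal public using (C; c; c⁻¹)
  open FreeMonad K free public using (M; _♯)
  private
    module H = Functor H
    module K = Functor K
    module M = Functor M

  GSOSRule : Set (o ⊔ h ⊔ e)
  GSOSRule = NaturalTransformation (K ∘F productFunctor products H idF) (H ∘F M)

  -- The defining equation of the ℓ-interpretation.  Terminality of C determines
  -- b by this equation, so uniqueness is not a separate clause.
  IsInterpretation : GSOSRule → K.F₀ C ⇒ C → Set e
  IsInterpretation ℓ b = c ∘ b ≈ H.F₁ (b ♯) ∘ ℓ.η C ∘ K.F₁ ⟨ c , id ⟩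
    where module ℓ = NaturalTransformation ℓ

  interpretationAlgebra : K.F₀ C ⇒ C → H.F₀ (M.F₀ C) ⇒ C
  interpretationAlgebra b = c⁻¹ ∘ H.F₁ (b ♯)

{-# OPTIONS --safe #-}

-- A morphism g : Y → HMY extends along the rule ℓ to a coalgebra ĝ : MY → HMY
-- making (MY, φ, ĝ) an ℓ-bialgebra.  The unique coalgebra homomorphism MY → C is
-- also a K-algebra homomorphism, so it is determined by its restriction to Y;
-- hence there is a unique v : Y → C with c ∘ v = H v̂ ∘ g, where v̂ : MY → C is the
-- K-algebra homomorphism extending v.  A flat equation X → HMX + C is encoded as
-- such a g on Y = X + C; there the component of v on C is forced to be the
-- identity, and its component on X is the solution.
module Submission where

open import Defs
open import Level using (Level)
open import Data.Product using (∃!; _,_)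

-- Rewriting rules for composites, products, coproducts and functor images.

module CategoryProperties {o h e : Level} (𝒞 : Category o h e) where
  open Category 𝒞

  pullˡ : ∀ {A B C D} {f : A ⇒ B} {g : B ⇒ C} {k : C ⇒ D} {u : B ⇒ D}
        → k ∘ g ≈ u → k ∘ g ∘ f ≈ u ∘ f
  pullˡ p = Equiv.trans (Equiv.sym assoc) (∘-resp-≈ˡ p)

  pullʳ : ∀ {A B C D} {f : A ⇒ B} {g : B ⇒ C} {k : C ⇒ D} {u : A ⇒ C}
        → g ∘ f ≈ u → (k ∘ g) ∘ f ≈ k ∘ u
  pullʳ p = Equiv.trans assoc (∘-resp-≈ʳ p)

  extendʳ : ∀ {A B B′ C D} {f : A ⇒ B} {g : B ⇒ C} {k : C ⇒ D} {g′ : B′ ⇒ D} {k′ : B ⇒ B′}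
          → k ∘ g ≈ g′ ∘ k′ → k ∘ g ∘ f ≈ g′ ∘ k′ ∘ f
  extendʳ p = Equiv.trans (pullˡ p) assoc

  module ProductProperties (products : BinaryProducts 𝒞) where
    open BinaryProducts products

    ⟨⟩-cong : ∀ {A B X} {f f′ : X ⇒ A} {g g′ : X ⇒ B} → f ≈ f′ → g ≈ g′ → ⟨ f , g ⟩ ≈ ⟨ f′ , g′ ⟩
    ⟨⟩-cong p q = unique (Equiv.trans project₁ (Equiv.sym p)) (Equiv.trans project₂ (Equiv.sym q))

    ⟨⟩∘ : ∀ {A B X Y} {f : X ⇒ A} {g : X ⇒ B} {k : Y ⇒ X} → ⟨ f , g ⟩ ∘ k ≈ ⟨ f ∘ k , g ∘ k ⟩
    ⟨⟩∘ = Equiv.sym (unique (pullˡ project₁) (pullˡ project₂))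

    ×₁∘⟨⟩ : ∀ {A B A′ B′ X} {f : A ⇒ A′} {g : B ⇒ B′} {u : X ⇒ A} {v : X ⇒ B}
          → (f ×₁ g) ∘ ⟨ u , v ⟩ ≈ ⟨ f ∘ u , g ∘ v ⟩
    ×₁∘⟨⟩ = Equiv.trans ⟨⟩∘ (⟨⟩-cong (pullʳ project₁) (pullʳ project₂))

  module CoproductProperties (coproducts : BinaryCoproducts 𝒞) where
    open BinaryCoproducts coproducts

    []-cong : ∀ {A B X} {f f′ : A ⇒ X} {g g′ : B ⇒ X} → f ≈ f′ → g ≈ g′ → [ f , g ] ≈ [ f′ , g′ ]
    []-cong p q = unique (Equiv.trans inject₁ (Equiv.sym p)) (Equiv.trans inject₂ (Equiv.sym q))

    ∘[] : ∀ {A B X Y} {f : A ⇒ X} {g : B ⇒ X} {k : X ⇒ Y} → k ∘ [ f , g ] ≈ [ k ∘ f , k ∘ g ]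
    ∘[] = Equiv.sym (unique (pullʳ inject₁) (pullʳ inject₂))

    []∘+₁ : ∀ {A B A′ B′ X} {f : A ⇒ A′} {g : B ⇒ B′} {u : A′ ⇒ X} {v : B′ ⇒ X}
          → [ u , v ] ∘ (f +₁ g) ≈ [ u ∘ f , v ∘ g ]
    []∘+₁ = Equiv.trans ∘[] ([]-cong (pullˡ inject₁) (pullˡ inject₂))

module FunctorProperties {o h e : Level} {𝒞 : Category o h e} (F : Endofunctor 𝒞) where
  open Category 𝒞
  open Functor F

  F₁-∘≈ : ∀ {A B D} {f : A ⇒ B} {g : B ⇒ D} {k : A ⇒ D} → g ∘ f ≈ k → F₁ g ∘ F₁ f ≈ F₁ k
  F₁-∘≈ p = Equiv.trans (Equiv.sym homomorphism) (F-resp-≈ p)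

  F₁-square : ∀ {A B B′ D} {f : A ⇒ B} {g : B ⇒ D} {f′ : A ⇒ B′} {g′ : B′ ⇒ D}
            → g ∘ f ≈ g′ ∘ f′ → F₁ g ∘ F₁ f ≈ F₁ g′ ∘ F₁ f′
  F₁-square p = Equiv.trans (F₁-∘≈ p) homomorphism

-- Homomorphisms out of free `K`-algebras.

module FreeAlgebraProperties {o h e : Level} {𝒞 : Category o h e} (K : Endofunctor 𝒞)
                             (free : (X : Category.Obj 𝒞) → FreeAlgebra K X) where
  open Category 𝒞
  open HomReasoning
  open CategoryProperties 𝒞
  open FreeMonad K free
  private
    module K = Functor K
    module Free (X : Obj) = FreeAlgebra (free X)

  extend : ∀ {X A} → K.F₀ A ⇒ A → X ⇒ A → M₀ X ⇒ A
  extend {X} = Free.extend X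

  extend-hom : ∀ {X A} (a : K.F₀ A ⇒ A) (f : X ⇒ A) → IsAlgebraHom K (φ X) a (extend a f)
  extend-hom {X} = Free.extend-hom X

  extend-η : ∀ {X A} (a : K.F₀ A ⇒ A) (f : X ⇒ A) → extend a f ∘ η X ≈ f
  extend-η {X} = Free.extend-η X

  extend-unique : ∀ {X A} {a : K.F₀ A ⇒ A} {f : X ⇒ A} {g : M₀ X ⇒ A}
                → IsAlgebraHom K (φ X) a g → g ∘ η X ≈ f → g ≈ extend a f
  extend-unique {X} {a = a} {f} = Free.extend-unique X a f

  extend-cong : ∀ {X A} {a : K.F₀ A ⇒ A} {f g : X ⇒ A} → f ≈ g → extend a f ≈ extend a g
  extend-cong {a = a} {f} p = extend-unique (extend-hom a f) (Equiv.trans (extend-η a f) p)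

  ∘-hom : ∀ {A B D} {a : K.F₀ A ⇒ A} {b : K.F₀ B ⇒ B} {d : K.F₀ D ⇒ D} {g : B ⇒ D} {f : A ⇒ B}
        → IsAlgebraHom K b d g → IsAlgebraHom K a b f → IsAlgebraHom K a d (g ∘ f)
  ∘-hom {a = a} {b} {d} {g} {f} p q = begin
    (g ∘ f) ∘ a            ≈⟨ pullʳ q ⟩
    g ∘ b ∘ K.F₁ f         ≈⟨ extendʳ p ⟩
    d ∘ K.F₁ g ∘ K.F₁ f    ≈⟨ ∘-resp-≈ʳ K.homomorphism ⟨
    d ∘ K.F₁ (g ∘ f)       ∎

  hom∘extend : ∀ {X A B} {a : K.F₀ A ⇒ A} {b : K.F₀ B ⇒ B} {g : A ⇒ B} {f : X ⇒ A}
             → IsAlgebraHom K a b g → g ∘ extend a f ≈ extend b (g ∘ f)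
  hom∘extend {a = a} {f = f} p =
    extend-unique (∘-hom p (extend-hom a f)) (pullʳ (extend-η a f))

  hom∘♯ : ∀ {A B} {a : K.F₀ A ⇒ A} {b : K.F₀ B ⇒ B} {g : A ⇒ B}
        → IsAlgebraHom K a b g → g ∘ a ♯ ≈ extend b g
  hom∘♯ p = Equiv.trans (hom∘extend p) (extend-cong identityʳ)

  extend∘M₁ : ∀ {X Y A} (a : K.F₀ A ⇒ A) (f : Y ⇒ A) (g : X ⇒ Y)
            → extend a f ∘ M₁ g ≈ extend a (f ∘ g)
  extend∘M₁ a f g =
    Equiv.trans (hom∘extend (extend-hom a f)) (extend-cong (pullˡ (extend-η a f)))

  ♯∘M₁ : ∀ {X A} (a : K.F₀ A ⇒ A) (f : X ⇒ A) → a ♯ ∘ M₁ f ≈ extend a f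
  ♯∘M₁ a f = Equiv.trans (extend∘M₁ a id f) (extend-cong identityˡ)

  -- Precomposing `a ♯` with `φ A ∘ K.F₁ (η A)`, the map κ from `K` to its free monad, gives back
  -- `a`. An equation between maps out of `M₀ A` therefore restricts along κ to the homomorphism
  -- law.
  ♯-reflects-hom : ∀ {A B} {a : K.F₀ A ⇒ A} {b : K.F₀ B ⇒ B} {g : A ⇒ B}
                 → g ∘ a ♯ ≈ extend b g → IsAlgebraHom K a b g
  ♯-reflects-hom {A} {B} {a} {b} {g} p = begin
    g ∘ a                                  ≈⟨ identityʳ ⟨
    (g ∘ a) ∘ id                           ≈⟨ ∘-resp-≈ʳ K.identity ⟨
    (g ∘ a) ∘ K.F₁ id                      ≈⟨ assoc ⟩
    g ∘ a ∘ K.F₁ id                        ≈⟨ ∘-resp-≈ʳ (∘-resp-≈ʳ (F₁-∘≈ (extend-η a id))) ⟨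
    g ∘ a ∘ K.F₁ (a ♯) ∘ K.F₁ (η A)        ≈⟨ ∘-resp-≈ʳ (extendʳ (extend-hom a id)) ⟨
    g ∘ a ♯ ∘ φ A ∘ K.F₁ (η A)             ≈⟨ pullˡ p ⟩
    extend b g ∘ φ A ∘ K.F₁ (η A)          ≈⟨ extendʳ (extend-hom b g) ⟩
    b ∘ K.F₁ (extend b g) ∘ K.F₁ (η A)     ≈⟨ ∘-resp-≈ʳ (F₁-∘≈ (extend-η b g)) ⟩
    b ∘ K.F₁ g                             ∎
    where open FunctorProperties K

-- Bialgebras for the rule `ℓ`.

module Bialgebras {o h e : Level} {𝒜 : Category o h e} (products : BinaryProducts 𝒜)
                  (H : Endofunctor 𝒜) (terminal : TerminalCoalgebra H)
                  (K : Endofunctor 𝒜) (free : (X : Category.Obj 𝒜) → FreeAlgebra K X)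
                  (ℓ : AbstractGSOS.GSOSRule products H terminal K free) where
  open Category 𝒜
  open HomReasoning
  open CategoryProperties 𝒜
  open BinaryProducts products
  open ProductProperties products
  open TerminalCoalgebra terminal
  open FreeMonad K free
  open FreeAlgebraProperties K free
  private
    module H where
      open Functor H public
      open FunctorProperties H public
    module K where
      open Functor K public
      open FunctorProperties K public
    module ℓ = NaturalTransformation ℓ

  IsBialgebra : ∀ {B} → K.F₀ B ⇒ B → B ⇒ H.F₀ B → Set e
  IsBialgebra {B} β γ = γ ∘ β ≈ H.F₁ (β ♯) ∘ ℓ.η B ∘ K.F₁ ⟨ γ , id ⟩

  -- Chosen so that the bialgebra law for `γ` becomes the statement that the graph `⟨ γ , id ⟩` is a
  -- `K`-algebra homomorphism; such maps can then be compared by freeness.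
  ruleAlgebra : ∀ {B} → K.F₀ B ⇒ B → K.F₀ (H.F₀ B × B) ⇒ H.F₀ B × B
  ruleAlgebra {B} β = ⟨ H.F₁ (β ♯) ∘ ℓ.η B , β ∘ K.F₁ π₂ ⟩

  -- The first component is naturality of `ℓ` at `w`, together with `w ∘ α ♯ ≈ β ♯ ∘ M₁ w`; the
  -- second is `p` itself.
  ×₁-hom : ∀ {A B} {α : K.F₀ A ⇒ A} {β : K.F₀ B ⇒ B} {w : A ⇒ B} → IsAlgebraHom K α β w
         → IsAlgebraHom K (ruleAlgebra α) (ruleAlgebra β) (H.F₁ w ×₁ w)
  ×₁-hom {A} {B} {α} {β} {w} p = begin
    (H.F₁ w ×₁ w) ∘ ruleAlgebra α
      ≈⟨ ×₁∘⟨⟩ ⟩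
    ⟨ H.F₁ w ∘ H.F₁ (α ♯) ∘ ℓ.η A , w ∘ α ∘ K.F₁ π₂ ⟩
      ≈⟨ ⟨⟩-cong first second ⟩
    ⟨ (H.F₁ (β ♯) ∘ ℓ.η B) ∘ K.F₁ (H.F₁ w ×₁ w) , (β ∘ K.F₁ π₂) ∘ K.F₁ (H.F₁ w ×₁ w) ⟩
      ≈⟨ ⟨⟩∘ ⟨
    ruleAlgebra β ∘ K.F₁ (H.F₁ w ×₁ w)
      ∎
    where
      first : H.F₁ w ∘ H.F₁ (α ♯) ∘ ℓ.η A ≈ (H.F₁ (β ♯) ∘ ℓ.η B) ∘ K.F₁ (H.F₁ w ×₁ w)
      first = begin
        H.F₁ w ∘ H.F₁ (α ♯) ∘ ℓ.η A
          ≈⟨ extendʳ (H.F₁-square (Equiv.trans (hom∘♯ p) (Equiv.sym (♯∘M₁ β w)))) ⟩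
        H.F₁ (β ♯) ∘ H.F₁ (M₁ w) ∘ ℓ.η A
          ≈⟨ pullʳ (ℓ.commute w) ⟨
        (H.F₁ (β ♯) ∘ ℓ.η B) ∘ K.F₁ (H.F₁ w ×₁ w)
          ∎

      second : w ∘ α ∘ K.F₁ π₂ ≈ (β ∘ K.F₁ π₂) ∘ K.F₁ (H.F₁ w ×₁ w)
      second = begin
        w ∘ α ∘ K.F₁ π₂                        ≈⟨ extendʳ p ⟩
        β ∘ K.F₁ w ∘ K.F₁ π₂                   ≈⟨ pullʳ (K.F₁-square project₂) ⟨
        (β ∘ K.F₁ π₂) ∘ K.F₁ (H.F₁ w ×₁ w)     ∎

  graph-hom : ∀ {B} {β : K.F₀ B ⇒ B} {γ : B ⇒ H.F₀ B} → IsBialgebra β γ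
            → IsAlgebraHom K β (ruleAlgebra β) ⟨ γ , id ⟩
  graph-hom {B} {β} {γ} p = begin
    ⟨ γ , id ⟩ ∘ β
      ≈⟨ ⟨⟩∘ ⟩
    ⟨ γ ∘ β , id ∘ β ⟩
      ≈⟨ ⟨⟩-cong (Equiv.trans p (Equiv.sym assoc)) second ⟩
    ⟨ (H.F₁ (β ♯) ∘ ℓ.η B) ∘ K.F₁ ⟨ γ , id ⟩ , (β ∘ K.F₁ π₂) ∘ K.F₁ ⟨ γ , id ⟩ ⟩
      ≈⟨ ⟨⟩∘ ⟨
    ruleAlgebra β ∘ K.F₁ ⟨ γ , id ⟩
      ∎
    where
      second : id ∘ β ≈ (β ∘ K.F₁ π₂) ∘ K.F₁ ⟨ γ , id ⟩
      second = begin
        id ∘ β                             ≈⟨ identityˡ ⟩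
        β                                  ≈⟨ identityʳ ⟨
        β ∘ id                             ≈⟨ ∘-resp-≈ʳ K.identity ⟨
        β ∘ K.F₁ id                        ≈⟨ pullʳ (K.F₁-∘≈ project₂) ⟨
        (β ∘ K.F₁ π₂) ∘ K.F₁ ⟨ γ , id ⟩    ∎

  -- Lifting `g` along `ℓ` to a coalgebra on the free algebra.

  module _ {Y : Obj} (g : Y ⇒ H.F₀ (M₀ Y)) where

    -- Primitive recursion on terms: `ℓ` needs each argument beside its behaviour, so the recursion
    -- computes both at once.
    liftedGraph : M₀ Y ⇒ H.F₀ (M₀ Y) × M₀ Y
    liftedGraph = extend (ruleAlgebra (φ Y)) ⟨ g , η Y ⟩

    lift : M₀ Y ⇒ H.F₀ (M₀ Y)
    lift = π₁ ∘ liftedGraph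

    -- By `project₂`, `π₂` is a homomorphism from `ruleAlgebra (φ Y)` to `φ Y`, so this composite is
    -- the extension of `η Y`.
    π₂∘liftedGraph : π₂ ∘ liftedGraph ≈ id
    π₂∘liftedGraph = begin
      π₂ ∘ liftedGraph                 ≈⟨ hom∘extend project₂ ⟩
      extend (φ Y) (π₂ ∘ ⟨ g , η Y ⟩)  ≈⟨ extend-cong (Equiv.trans project₂ (Equiv.sym identityʳ)) ⟩
      M₁ id                            ≈⟨ Functor.identity M ⟩
      id                               ∎

    liftedGraph-graph : ⟨ lift , id ⟩ ≈ liftedGraph
    liftedGraph-graph = unique Equiv.refl π₂∘liftedGraph

    lift∘η : lift ∘ η Y ≈ g
    lift∘η = Equiv.trans (pullʳ (extend-η _ _)) project₁

    lift-isBialgebra : IsBialgebra (φ Y) lift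
    lift-isBialgebra = begin
      (π₁ ∘ liftedGraph) ∘ φ Y
        ≈⟨ pullʳ (extend-hom _ _) ⟩
      π₁ ∘ ruleAlgebra (φ Y) ∘ K.F₁ liftedGraph
        ≈⟨ pullˡ project₁ ⟩
      (H.F₁ (φ Y ♯) ∘ ℓ.η (M₀ Y)) ∘ K.F₁ liftedGraph
        ≈⟨ pullʳ (∘-resp-≈ʳ (K.F-resp-≈ (Equiv.sym liftedGraph-graph))) ⟩
      H.F₁ (φ Y ♯) ∘ ℓ.η (M₀ Y) ∘ K.F₁ ⟨ lift , id ⟩
        ∎

    -- The target is arbitrary because solutions are needed both in `C` and in other bialgebras, as
    -- in `unfold-algebraHom`.
    IsSolutionIn : ∀ {B} → K.F₀ B ⇒ B → B ⇒ H.F₀ B → Y ⇒ B → Set e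
    IsSolutionIn β γ v = γ ∘ v ≈ H.F₁ (extend β v) ∘ g

    -- Paired with `v̂` as second component, both sides are homomorphisms into `ruleAlgebra β` out
    -- of a free algebra. They agree on generators exactly because `v` is a solution; the first
    -- projection gives the claim.
    extend-coalgebraHom : ∀ {B} {β : K.F₀ B ⇒ B} {γ : B ⇒ H.F₀ B} {v : Y ⇒ B} → IsBialgebra β γ
                        → IsSolutionIn β γ v → IsCoalgebraHom H lift γ (extend β v)
    extend-coalgebraHom {β = β} {γ} {v} bialg sol = begin
      γ ∘ v̂                                ≈⟨ project₁ ⟨
      π₁ ∘ ⟨ γ ∘ v̂ , id ∘ v̂ ⟩              ≈⟨ ∘-resp-≈ʳ ⟨⟩∘ ⟨
      π₁ ∘ ⟨ γ , id ⟩ ∘ v̂                  ≈⟨ ∘-resp-≈ʳ graphs-agree ⟩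
      π₁ ∘ (H.F₁ v̂ ×₁ v̂) ∘ liftedGraph     ≈⟨ extendʳ project₁ ⟩
      H.F₁ v̂ ∘ lift                        ∎
      where
        v̂ = extend β v

        agree-on-Y : ⟨ γ , id ⟩ ∘ v ≈ (H.F₁ v̂ ×₁ v̂) ∘ ⟨ g , η Y ⟩
        agree-on-Y = begin
          ⟨ γ , id ⟩ ∘ v
            ≈⟨ ⟨⟩∘ ⟩
          ⟨ γ ∘ v , id ∘ v ⟩
            ≈⟨ ⟨⟩-cong sol (Equiv.trans identityˡ (Equiv.sym (extend-η β v))) ⟩
          ⟨ H.F₁ v̂ ∘ g , v̂ ∘ η Y ⟩
            ≈⟨ ×₁∘⟨⟩ ⟨
          (H.F₁ v̂ ×₁ v̂) ∘ ⟨ g , η Y ⟩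
            ∎

        graphs-agree : ⟨ γ , id ⟩ ∘ v̂ ≈ (H.F₁ v̂ ×₁ v̂) ∘ liftedGraph
        graphs-agree = begin
          ⟨ γ , id ⟩ ∘ v̂
            ≈⟨ hom∘extend (graph-hom bialg) ⟩
          extend (ruleAlgebra β) (⟨ γ , id ⟩ ∘ v)
            ≈⟨ extend-cong agree-on-Y ⟩
          extend (ruleAlgebra β) ((H.F₁ v̂ ×₁ v̂) ∘ ⟨ g , η Y ⟩)
            ≈⟨ hom∘extend (×₁-hom (extend-hom β v)) ⟨
          (H.F₁ v̂ ×₁ v̂) ∘ liftedGraph
            ∎

  -- A coalgebra is a special equation whose right-hand sides contain only variables, embedded by
  -- `η`; extending `f` and restricting along `η` returns `f`.
  coalgebraHom⇒solution : ∀ {A B} {α : A ⇒ H.F₀ A} (β : K.F₀ B ⇒ B) {γ : B ⇒ H.F₀ B} {f : A ⇒ B}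
                        → IsCoalgebraHom H α γ f → IsSolutionIn (H.F₁ (η A) ∘ α) β γ f
  coalgebraHom⇒solution {A} {α = α} β {γ} {f} p = begin
    γ ∘ f                                   ≈⟨ p ⟩
    H.F₁ f ∘ α                              ≈⟨ pullˡ (H.F₁-∘≈ (extend-η β f)) ⟨
    H.F₁ (extend β f) ∘ H.F₁ (η A) ∘ α      ∎

  -- Unique solutions in the terminal coalgebra.

  module _ {b : K.F₀ C ⇒ C} (interp : IsBialgebra b c) where

    -- Both sides of unfold α ∘ a ♯ = extend b (unfold α) are coalgebra
    -- homomorphisms into C from the lift of H η ∘ α to MA.
    unfold-algebraHom : ∀ {A} {a : K.F₀ A ⇒ A} {α : A ⇒ H.F₀ A} → IsBialgebra a α
                      → IsAlgebraHom K a b (unfold α)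
    unfold-algebraHom {A} {a} {α} bialg = ♯-reflects-hom (Equiv.trans
      (unfold-unique (lift g) (begin
        c ∘ unfold α ∘ a ♯                       ≈⟨ extendʳ (unfold-hom α) ⟩
        H.F₁ (unfold α) ∘ α ∘ a ♯                ≈⟨ ∘-resp-≈ʳ ♯-coalgebraHom ⟩
        H.F₁ (unfold α) ∘ H.F₁ (a ♯) ∘ lift g    ≈⟨ pullˡ (Equiv.sym H.homomorphism) ⟩
        H.F₁ (unfold α ∘ a ♯) ∘ lift g           ∎))
      (Equiv.sym (unfold-unique (lift g)
        (extend-coalgebraHom g interp (coalgebraHom⇒solution b (unfold-hom α))))))
      where
        g = H.F₁ (η A) ∘ α

        -- Since `a ♯` is `extend a id`, it is enough that `id` is a coalgebra homomorphism from `α`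
        -- to itself.
        ♯-coalgebraHom : IsCoalgebraHom H (lift g) α (a ♯)
        ♯-coalgebraHom = extend-coalgebraHom g bialg (coalgebraHom⇒solution a (begin
          α ∘ id         ≈⟨ identityʳ ⟩
          α              ≈⟨ identityˡ ⟨
          id ∘ α         ≈⟨ ∘-resp-≈ˡ H.identity ⟨
          H.F₁ id ∘ α    ∎))

    uniqueSolution : ∀ {Y} (g : Y ⇒ H.F₀ (M₀ Y)) → ∃! _≈_ (IsSolutionIn g b c)
    uniqueSolution {Y} g = t ∘ η Y , solution , uniqueness
      where
        t = unfold (lift g)

        solution : IsSolutionIn g b c (t ∘ η Y)
        solution = begin
          c ∘ t ∘ η Y                       ≈⟨ extendʳ (unfold-hom (lift g)) ⟩
          H.F₁ t ∘ lift g ∘ η Y             ≈⟨ ∘-resp-≈ (H.F-resp-≈ t-extends) (lift∘η g) ⟩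
          H.F₁ (extend b (t ∘ η Y)) ∘ g     ∎
          where
            -- This turns the coalgebra equation for `t` into the solution equation for its
            -- restriction to generators.
            t-extends : t ≈ extend b (t ∘ η Y)
            t-extends = extend-unique (unfold-algebraHom (lift-isBialgebra g)) Equiv.refl

        uniqueness : ∀ {v} → IsSolutionIn g b c v → t ∘ η Y ≈ v
        uniqueness {v} sol = begin
          t ∘ η Y              ≈⟨ ∘-resp-≈ˡ (unfold-unique (lift g) (extend-coalgebraHom g interp sol)) ⟨
          extend b v ∘ η Y     ≈⟨ extend-η b v ⟩
          v                    ∎

-- Encoding flat equations and decoding their solutions.

module FlatEquations {o h e : Level} {𝒜 : Category o h e} (products : BinaryProducts 𝒜)
                     (coproducts : BinaryCoproducts 𝒜)
                     (H : Endofunctor 𝒜) (terminal : TerminalCoalgebra H)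
                     (K : Endofunctor 𝒜) (free : (X : Category.Obj 𝒜) → FreeAlgebra K X)
                     (ℓ : AbstractGSOS.GSOSRule products H terminal K free)
                     (b : Category._⇒_ 𝒜 (Functor.F₀ K (TerminalCoalgebra.C terminal))
                                         (TerminalCoalgebra.C terminal)) where
  open Category 𝒜
  open HomReasoning
  open CategoryProperties 𝒜
  open BinaryCoproducts coproducts
  open CoproductProperties coproducts
  open TerminalCoalgebra terminal
  open FreeMonad K free
  open FreeAlgebraProperties K free
  open AbstractGSOS products H terminal K free using (IsInterpretation; interpretationAlgebra)
  open Bialgebras products H terminal K free ℓ
  private
    module H where
      open Functor H public
      open FunctorProperties H public

  k : H.F₀ (M₀ C) ⇒ C
  k = interpretationAlgebra b

  c∘-cancel : ∀ {A} {f g : A ⇒ C} → c ∘ f ≈ c ∘ g → f ≈ g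
  c∘-cancel {f = f} {g} p = begin
    f            ≈⟨ identityˡ ⟨
    id ∘ f       ≈⟨ pullˡ c⁻¹∘c≈id ⟨
    c⁻¹ ∘ c ∘ f  ≈⟨ ∘-resp-≈ʳ p ⟩
    c⁻¹ ∘ c ∘ g  ≈⟨ pullˡ c⁻¹∘c≈id ⟩
    id ∘ g       ≈⟨ identityˡ ⟩
    g            ∎

  module _ {X : Obj} (eq : FlatEquation coproducts (H ∘F M) X C) where

    -- Composing with `c` cancels the `c⁻¹` in `k`, and `b ♯ ∘ M₁ s` is `extend b s`; the flat
    -- equation thus takes the shape of `IsSolutionIn`.
    c∘rhs : (s : X ⇒ C) → c ∘ [ k , id ] ∘ (H.F₁ (M₁ s) +₁ id) ∘ eq ≈ [ H.F₁ (extend b s) , c ] ∘ eq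
    c∘rhs s = begin
      c ∘ [ k , id ] ∘ (H.F₁ (M₁ s) +₁ id) ∘ eq       ≈⟨ pullˡ ∘[] ⟩
      [ c ∘ k , c ∘ id ] ∘ (H.F₁ (M₁ s) +₁ id) ∘ eq   ≈⟨ pullˡ []∘+₁ ⟩
      [ (c ∘ k) ∘ H.F₁ (M₁ s) , (c ∘ id) ∘ id ] ∘ eq
        ≈⟨ ∘-resp-≈ˡ ([]-cong first (Equiv.trans identityʳ identityʳ)) ⟩
      [ H.F₁ (extend b s) , c ] ∘ eq                  ∎
      where
        first : (c ∘ k) ∘ H.F₁ (M₁ s) ≈ H.F₁ (extend b s)
        first = begin
          (c ∘ c⁻¹ ∘ H.F₁ (b ♯)) ∘ H.F₁ (M₁ s)   ≈⟨ ∘-resp-≈ˡ (pullˡ c∘c⁻¹≈id) ⟩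
          (id ∘ H.F₁ (b ♯)) ∘ H.F₁ (M₁ s)        ≈⟨ ∘-resp-≈ˡ identityˡ ⟩
          H.F₁ (b ♯) ∘ H.F₁ (M₁ s)               ≈⟨ H.F₁-∘≈ (♯∘M₁ b s) ⟩
          H.F₁ (extend b s)                      ∎

    -- An element of `C` behaves as it does under `c`, its successors being read again as parameters
    -- in the right summand.
    constants : C ⇒ H.F₀ (M₀ (X + C))
    constants = H.F₁ (η (X + C) ∘ i₂) ∘ c

    -- Where `eq` returns a parameter instead of an `H`-guarded term, the parameter is unfolded at
    -- once by `constants`, so every right-hand side lies in `H.F₀ (M₀ (X + C))`.
    encode : X + C ⇒ H.F₀ (M₀ (X + C))
    encode = [ [ H.F₁ (M₁ i₁) , constants ] ∘ eq , constants ]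

    extend∘constants : (v : X + C ⇒ C) → H.F₁ (extend b v) ∘ constants ≈ H.F₁ (v ∘ i₂) ∘ c
    extend∘constants v = pullˡ (H.F₁-∘≈ (pullˡ (extend-η b v)))

    -- The component `v ∘ i₂` stays arbitrary here, since for a solution of `encode` it has yet to
    -- be shown to be `id`.
    extend∘encode : (v : X + C ⇒ C) → H.F₁ (extend b v) ∘ encode
                  ≈ [ [ H.F₁ (extend b (v ∘ i₁)) , H.F₁ (v ∘ i₂) ∘ c ] ∘ eq , H.F₁ (v ∘ i₂) ∘ c ]
    extend∘encode v = Equiv.trans ∘[] ([]-cong
      (Equiv.trans (pullˡ ∘[])
        (∘-resp-≈ˡ ([]-cong (H.F₁-∘≈ (extend∘M₁ b v i₁)) (extend∘constants v))))
      (extend∘constants v))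

    Hid∘c : {r : C ⇒ C} → r ≈ id → H.F₁ r ∘ c ≈ c
    Hid∘c p = Equiv.trans (∘-resp-≈ˡ (Equiv.trans (H.F-resp-≈ p) H.identity)) identityˡ

    solution⇒encode : {s : X ⇒ C} → IsSolution coproducts (H ∘F M) k eq s
                    → IsSolutionIn encode b c [ s , id ]
    solution⇒encode {s} sol = begin
      c ∘ [ s , id ]
        ≈⟨ ∘[] ⟩
      [ c ∘ s , c ∘ id ]
        ≈⟨ []-cong (Equiv.trans (∘-resp-≈ʳ sol) (c∘rhs s)) identityʳ ⟩
      [ [ H.F₁ (extend b s) , c ] ∘ eq , c ]
        ≈⟨ []-cong (∘-resp-≈ˡ ([]-cong (H.F-resp-≈ (extend-cong inject₁)) (Hid∘c inject₂)))
                   (Hid∘c inject₂) ⟨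
      [ [ H.F₁ (extend b (v ∘ i₁)) , H.F₁ (v ∘ i₂) ∘ c ] ∘ eq , H.F₁ (v ∘ i₂) ∘ c ]
        ≈⟨ extend∘encode v ⟨
      H.F₁ (extend b v) ∘ encode
        ∎
      where v = [ s , id ]

    -- As `c` has a left inverse, the equation need only be checked after composing with `c`, where
    -- it is the `X`-component of `sol`.
    encode⇒solution : {v : X + C ⇒ C} → IsSolutionIn encode b c v
                    → IsSolution coproducts (H ∘F M) k eq (v ∘ i₁)
    encode⇒solution {v} sol = c∘-cancel (begin
      c ∘ v ∘ i₁
        ≈⟨ pullˡ components ⟩
      [ [ H.F₁ (extend b (v ∘ i₁)) , H.F₁ (v ∘ i₂) ∘ c ] ∘ eq , H.F₁ (v ∘ i₂) ∘ c ] ∘ i₁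
        ≈⟨ inject₁ ⟩
      [ H.F₁ (extend b (v ∘ i₁)) , H.F₁ (v ∘ i₂) ∘ c ] ∘ eq
        ≈⟨ ∘-resp-≈ˡ ([]-cong Equiv.refl (Hid∘c v∘i₂)) ⟩
      [ H.F₁ (extend b (v ∘ i₁)) , c ] ∘ eq
        ≈⟨ c∘rhs (v ∘ i₁) ⟨
      c ∘ [ k , id ] ∘ (H.F₁ (M₁ (v ∘ i₁)) +₁ id) ∘ eq
        ∎)
      where
        components = Equiv.trans sol (extend∘encode v)

        -- The `C`-component of `sol` makes `v ∘ i₂` a coalgebra endomorphism of `C`, as `id` is;
        -- terminality identifies them.
        v∘i₂ : v ∘ i₂ ≈ id
        v∘i₂ = Equiv.trans (unfold-unique c (Equiv.trans (pullˡ components) inject₂))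
          (Equiv.sym (unfold-unique c (Equiv.trans identityʳ (Equiv.sym (Hid∘c Equiv.refl)))))

  isCIA : IsInterpretation ℓ b → IsCIA coproducts (H ∘F M) k
  isCIA interp eq with uniqueSolution interp (encode eq)
  -- For uniqueness, a competing solution `s` is extended by `id` on parameters, and the extension
  -- must equal `v`.
  ... | v , sol , uniq = v ∘ i₁ , encode⇒solution eq sol , λ {s} s-sol → begin
    v ∘ i₁             ≈⟨ ∘-resp-≈ˡ (uniq (solution⇒encode eq s-sol)) ⟩
    [ s , id ] ∘ i₁    ≈⟨ inject₁ ⟩
    s                  ∎

mainTheorem2 : {o h e : Level} (𝒜 : Category o h e)
    (products : BinaryProducts 𝒜) (coproducts : BinaryCoproducts 𝒜)
    (H : Endofunctor 𝒜) (terminal : TerminalCoalgebra H)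
    (K : Endofunctor 𝒜) (free : (X : Category.Obj 𝒜) → FreeAlgebra K X) →
    let open Category 𝒜
        open AbstractGSOS products H terminal K free
    in (ℓ : GSOSRule) (b : Functor.F₀ K C ⇒ C) → IsInterpretation ℓ b →
       IsCIA coproducts (H ∘F M) (interpretationAlgebra b)
mainTheorem2 𝒜 products coproducts H terminal K free ℓ b interp =
  FlatEquations.isCIA products coproducts H terminal K free ℓ b interp
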